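{- Let $G$ be a fixed edge-ordered graph with labeling $l$ whose minimal edge is $ab$. If there exist two vertices $v,w\in N_G(a)\cap N_G(b)$ such that $l(av)<l(aw)$ and $l(bv)>l(bw)$, then \[sat_m(n,G)\ \ge\ ssat_m(n,G)=\Omega(n\sqrt{\log n}).\]
   Context: An edge-ordered graph is a finite simple graph together with a linear order on its edge set given by an injective labeling $l:E\to\mathbb{N}$ (or $l:E\to\mathbb{R}$). An edge-ordered graph $H$ contains $G$ (has a copy of $G$) if $G$ is isomorphic, by an isomorphism respecting the edge-order, to a subgraph of $H$ with the induced order; otherwise $H$ is $G$-free. The minimal edge is the edge with the smallest label. $N_G(a)$ denotes the open neighborhood of $a$ in $G$. $ssat_m(n,G)$ is the minimum number of edges in an edge-ordered graph $H$ on $n$ vertices such that adding to $H$ any missing edge, inserted at the beginning of the linear order (i.e. with a label smaller than all labels of $H$), creates a new copy of $G$ (one using the added edge). $sat_m(n,G)$ is defined in the same way with the additional requirement that $H$ is $G$-free. Asymptotic notation is for $n\to\infty$ with $G$ fixed. -}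

module Defs where

open import Data.Bool.Base using (if_then_else_)
open import Data.Empty using (⊥-elim)
open import Data.Fin.Base using (Fin; _<_)
open import Data.Fin.Properties using (_≟_; _<?_)
open import Data.List.Base using (length; filter; cartesianProduct; allFin)
open import Data.Nat.Base as ℕ using (ℕ; suc; _*_; _^_)
open import Data.Nat.Logarithm using (⌈log₂_⌉)
open import Data.Nat.Properties using (suc-injective)
open import Data.Product.Base using (Σ; ∃-syntax; _×_; _,_; proj₁; proj₂)
open import Data.Sum.Base using (_⊎_; inj₁; inj₂)
open import Function.Definitions using (Injective)
open import Level using (Level; 0ℓ) renaming (suc to lsuc)
open import Relation.Binary.Core using (Rel)
open import Relation.Binary.Definitions using (Symmetric; Decidable)
open import Relation.Binary.PropositionalEquality
  using (_≡_; _≢_; refl; sym; trans; cong)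
open import Relation.Nullary using (¬_; Dec; yes; no; does)
open import Relation.Nullary.Decidable using (_×-dec_; _⊎-dec_)
open import Relation.Unary using (Pred)

private variable
  k n : ℕ

-- {u , v} = {x , y} as unordered pairs.
SameEdge : (u v x y : Fin n) → Set
SameEdge u v x y = (u ≡ x × v ≡ y) ⊎ (u ≡ y × v ≡ x)

sameEdge? : (u v x y : Fin n) → Dec (SameEdge u v x y)
sameEdge? u v x y =
  ((u ≟ x) ×-dec (v ≟ y)) ⊎-dec ((u ≟ y) ×-dec (v ≟ x))

-- The values of label at non-adjacent pairs carry no meaning: they are
-- unconstrained here and are never compared below.
record EdgeOrderedGraph (n : ℕ) : Set₁ where
  field
    Adj             : Rel (Fin n) 0ℓ
    adj?            : Decidable Adj
    adj-sym         : Symmetric Adj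
    adj-irrefl      : ∀ {u} → ¬ Adj u u
    label           : Fin n → Fin n → ℕ
    label-sym       : ∀ {u v} → Adj u v → label u v ≡ label v u
    label-injective : ∀ {u v x y} → Adj u v → Adj x y →
                      label u v ≡ label x y → SameEdge u v x y

open EdgeOrderedGraph public

N : EdgeOrderedGraph n → Fin n → Pred (Fin n) 0ℓ
N G u v = Adj G u v

edgeCount : EdgeOrderedGraph n → ℕ
edgeCount {n} G =
  length (filter (λ p → (proj₁ p <? proj₂ p) ×-dec adj? G (proj₁ p) (proj₂ p))
                 (cartesianProduct (allFin n) (allFin n)))

IsMinimalEdge : EdgeOrderedGraph n → (a b : Fin n) → Set
IsMinimalEdge G a b =
  Adj G a b × (∀ {u v} → Adj G u v → label G a b ℕ.≤ label G u v)

-- An isomorphism of G onto a (not necessarily induced) subgraph of H that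
-- carries the edge-order of G to the restriction of that of H.
record Copy (G : EdgeOrderedGraph k) (H : EdgeOrderedGraph n) : Set where
  field
    to          : Fin k → Fin n
    injective   : Injective _≡_ _≡_ to
    adj-pres    : ∀ {u v} → Adj G u v → Adj H (to u) (to v)
    order-pres  : ∀ {u v x y} → Adj G u v → Adj G x y →
                  label G u v ℕ.< label G x y →
                  label H (to u) (to v) ℕ.< label H (to x) (to y)

open Copy public

Free : EdgeOrderedGraph k → EdgeOrderedGraph n → Set
Free G H = ¬ Copy G H

Uses : {G : EdgeOrderedGraph k} {H : EdgeOrderedGraph n} →
       Copy G H → (x y : Fin n) → Set
Uses {G = G} c x y =
  ∃[ u ] ∃[ v ] Adj G u v × SameEdge (to c u) (to c v) x y

Missing : EdgeOrderedGraph n → (x y : Fin n) → Set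
Missing H x y = x ≢ y × ¬ Adj H x y

private
  SameEdge-flip : {u v x y : Fin n} → SameEdge u v x y → SameEdge v u x y
  SameEdge-flip (inj₁ (p , q)) = inj₂ (q , p)
  SameEdge-flip (inj₂ (p , q)) = inj₁ (q , p)

  SameEdge-join : {u v u′ v′ x y : Fin n} →
                  SameEdge u v x y → SameEdge u′ v′ x y → SameEdge u v u′ v′
  SameEdge-join (inj₁ (refl , refl)) (inj₁ (refl , refl)) = inj₁ (refl , refl)
  SameEdge-join (inj₁ (refl , refl)) (inj₂ (refl , refl)) = inj₂ (refl , refl)
  SameEdge-join (inj₂ (refl , refl)) (inj₁ (refl , refl)) = inj₂ (refl , refl)
  SameEdge-join (inj₂ (refl , refl)) (inj₂ (refl , refl)) = inj₁ (refl , refl)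

-- H with the edge xy inserted at the beginning of the order.  Labels being
-- natural numbers, the old ones are shifted up by one to make room for 0.
addFirst : (H : EdgeOrderedGraph n) (x y : Fin n) → Missing H x y →
           EdgeOrderedGraph n
addFirst {n} H x y (x≢y , _) = record
  { Adj             = Adj⁺
  ; adj?            = λ u v → sameEdge? u v x y ⊎-dec adj? H u v
  ; adj-sym         = λ { (inj₁ e) → inj₁ (SameEdge-flip e)
                        ; (inj₂ e) → inj₂ (adj-sym H e) }
  ; adj-irrefl      = λ { (inj₁ (inj₁ (p , q))) → x≢y (trans (sym p) q)
                        ; (inj₁ (inj₂ (p , q))) → x≢y (trans (sym q) p)
                        ; (inj₂ e) → adj-irrefl H e }
  ; label           = label⁺
  ; label-sym       = label⁺-sym
  ; label-injective = label⁺-injective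
  }
  where
  Adj⁺ : Rel (Fin n) 0ℓ
  Adj⁺ u v = SameEdge u v x y ⊎ Adj H u v

  label⁺ : Fin n → Fin n → ℕ
  label⁺ u v = if does (sameEdge? u v x y) then 0 else suc (label H u v)

  old : ∀ {u v} → ¬ SameEdge u v x y → Adj⁺ u v → Adj H u v
  old ¬e (inj₁ e) = ⊥-elim (¬e e)
  old ¬e (inj₂ e) = e

  label⁺-sym : ∀ {u v} → Adj⁺ u v → label⁺ u v ≡ label⁺ v u
  label⁺-sym {u} {v} e = go (sameEdge? u v x y) (sameEdge? v u x y)
    where
    go : (d : Dec (SameEdge u v x y)) (d′ : Dec (SameEdge v u x y)) →
         (if does d then 0 else suc (label H u v)) ≡
         (if does d′ then 0 else suc (label H v u))
    go (yes _) (yes _) = refl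
    go (yes p) (no ¬q) = ⊥-elim (¬q (SameEdge-flip p))
    go (no ¬p) (yes q) = ⊥-elim (¬p (SameEdge-flip q))
    go (no ¬p) (no _)  = cong suc (label-sym H (old ¬p e))

  label⁺-injective : ∀ {u v u′ v′} → Adj⁺ u v → Adj⁺ u′ v′ →
                     label⁺ u v ≡ label⁺ u′ v′ → SameEdge u v u′ v′
  label⁺-injective {u} {v} {u′} {v′} e e′ =
    go (sameEdge? u v x y) (sameEdge? u′ v′ x y)
    where
    go : (d : Dec (SameEdge u v x y)) (d′ : Dec (SameEdge u′ v′ x y)) →
         (if does d then 0 else suc (label H u v)) ≡
         (if does d′ then 0 else suc (label H u′ v′)) →
         SameEdge u v u′ v′
    go (yes p) (yes q) _ = SameEdge-join p q
    go (no ¬p) (no ¬q) eq =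
      label-injective H (old ¬p e) (old ¬q e′) (suc-injective eq)

SemiSaturated : EdgeOrderedGraph k → EdgeOrderedGraph n → Set
SemiSaturated G H =
  ∀ x y (m : Missing H x y) →
  Σ (Copy G (addFirst H x y m)) λ c → Uses c x y

Saturated : EdgeOrderedGraph k → EdgeOrderedGraph n → Set
Saturated G H = Free G H × SemiSaturated G H

IsMinimum : {ℓ : Level} → Pred ℕ ℓ → Pred ℕ ℓ
IsMinimum P m = P m × (∀ m′ → P m′ → m ℕ.≤ m′)

-- The functions ssatₘ(n, G) and satₘ(n, G) are given by their graphs:
-- "ssatₘ G n s" reads "ssatₘ(n, G) = s".
ssatₘ : EdgeOrderedGraph k → ℕ → Pred ℕ (lsuc 0ℓ)
ssatₘ G n = IsMinimum λ s →
  Σ (EdgeOrderedGraph n) λ H → SemiSaturated G H × edgeCount H ≡ s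

satₘ : EdgeOrderedGraph k → ℕ → Pred ℕ (lsuc 0ℓ)
satₘ G n = IsMinimum λ s →
  Σ (EdgeOrderedGraph n) λ H → Saturated G H × edgeCount H ≡ s

-- f(n) = Ω(n √(log n)) for f given by its graph F.  With implied constant 1/C
-- the bound is n √(log n) ≤ C f(n), written here with both sides squared.
-- Rounding log₂ n up changes it by a factor of at most 2 once n ≥ 2.
Ω[n√logn] : {ℓ : Level} → (ℕ → Pred ℕ ℓ) → Set ℓ
Ω[n√logn] F =
  ∃[ C ] ∃[ n₀ ] ∀ n s → n₀ ℕ.≤ n → F n s → n ^ 2 * ⌈log₂ n ⌉ ℕ.≤ (C * s) ^ 2

{-# OPTIONS --safe #-}
-- Inserting a missing edge xy at the beginning of the order creates a copy of
-- G in which xy plays the role of ab, so x and y have common neighbours v, w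
-- with l(xv) < l(xw) and l(yv) > l(yw).  Let every vertex x prescribe, for each
-- pair (v , w) of its neighbours, the truth value of l(xv) < l(xw).  Among all
-- assignments of truth values to the pairs of vertices, a vertex of degree at
-- most d is respected by a fraction at least 2^(-d²), and the vertices
-- respected by one assignment form a clique.  Hence at most (d + 1) 2^(d²)
-- vertices have degree at most d.  With d ≈ √(log n) this is less than n / 2,
-- so at least half of the vertices have degree greater than d.
module Submission where

open import Defs
open import Data.Bool.Base using (Bool; true; false; if_then_else_)
import Data.Bool.Properties as Bool
open import Data.Fin.Base using (Fin) renaming (_<_ to _<ᶠ_)
open import Data.Fin.Properties using (_≟_) renaming (_<?_ to _<ᶠ?_; <-cmp to <ᶠ-cmp)
open import Data.List.Base using (List; []; _∷_; map; length; filter; cartesianProduct; allFin)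
open import Data.List.Membership.Propositional.Properties using (∈-allFin; ∈-cartesianProduct⁺)
open import Data.List.Properties
  using (filter-++; filter-all; filter-none; length-++; length-tabulate; map-cong)
open import Data.List.Relation.Binary.Sublist.Propositional using (_⊆_; []; _∷_; _∷ʳ_; ⊆-refl; ⊆-trans)
open import Data.List.Relation.Binary.Sublist.Propositional.Properties
  using (All-resp-⊆; filter-⊆; filter⁺; length-mono-≤)
open import Data.List.Relation.Unary.All as All using (All; []; _∷_)
open import Data.List.Relation.Unary.All.Properties using (all-filter)
open import Data.List.Relation.Unary.AllPairs as AllPairs using (AllPairs; []; _∷_)
open import Data.List.Relation.Unary.Unique.Propositional.Properties using (allFin⁺)
open import Data.Nat.Base using (ℕ; zero; suc; _+_; _*_; _^_; _≤_; _<_; z≤n; s≤s)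
open import Data.Nat.ListAction using (sum)
open import Data.Nat.Logarithm using (⌈log₂_⌉; ⌈log₂⌉-mono-≤; ⌈log₂2^n⌉≡n)
open import Data.Nat.Properties hiding (_≟_)
open import Data.Nat.Tactic.RingSolver using (solve-∀)
open import Data.Product.Base using (_×_; _,_; proj₁; proj₂; ∃-syntax)
open import Data.Sum.Base using (_⊎_; inj₁; inj₂)
open import Function.Base using (_∘_; id)
open import Level using (0ℓ)
open import Relation.Binary.Core using (Rel; REL)
open import Relation.Binary.Definitions using (Decidable; tri<; tri≈; tri>)
open import Relation.Binary.PropositionalEquality
  using (_≡_; _≢_; refl; sym; trans; cong; cong₂; subst; subst₂)
open import Relation.Nullary using (¬_; yes; no; does; contradiction)
open import Relation.Nullary.Decidable using (_×-dec_; _→-dec_; dec-true; dec-false)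
open import Relation.Unary as Unary using (Pred; _∈_; _∩_)
open import Relation.Unary.Properties using (U?)

private variable
  A B : Set

-- Counting and summation over lists

sum-map-mono : {f g : A → ℕ} → (∀ x → f x ≤ g x) → ∀ xs → sum (map f xs) ≤ sum (map g xs)
sum-map-mono f≤g []       = z≤n
sum-map-mono f≤g (x ∷ xs) = +-mono-≤ (f≤g x) (sum-map-mono f≤g xs)

sum-map-+ : (f g : A → ℕ) → ∀ xs →
            sum (map (λ x → f x + g x) xs) ≡ sum (map f xs) + sum (map g xs)
sum-map-+ f g []       = refl
sum-map-+ f g (x ∷ xs) = trans (cong (f x + g x +_) (sum-map-+ f g xs)) (interchange (f x) (g x) _ _)
  where
  interchange : ∀ a b c d → a + b + (c + d) ≡ a + c + (b + d)
  interchange = solve-∀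

sum-map-0 : (xs : List A) → sum (map (λ _ → 0) xs) ≡ 0
sum-map-0 []       = refl
sum-map-0 (x ∷ xs) = sum-map-0 xs

count : {P : Pred A 0ℓ} → Unary.Decidable P → List A → ℕ
count P? xs = length (filter P? xs)

count-∷ : {P : Pred A 0ℓ} (P? : Unary.Decidable P) (x : A) (xs : List A) →
          count P? (x ∷ xs) ≡ (if does (P? x) then 1 else 0) + count P? xs
count-∷ P? x xs with does (P? x)
... | true  = refl
... | false = refl

count-as-sum : {P : Pred A 0ℓ} (P? : Unary.Decidable P) (xs : List A) →
               count P? xs ≡ sum (map (λ x → if does (P? x) then 1 else 0) xs)
count-as-sum P? []       = refl
count-as-sum P? (x ∷ xs) = trans (count-∷ P? x xs) (cong (_ +_) (count-as-sum P? xs))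

count-mono : {P Q : Pred A 0ℓ} (P? : Unary.Decidable P) (Q? : Unary.Decidable Q) →
             (∀ {x} → P x → Q x) → ∀ xs → count P? xs ≤ count Q? xs
count-mono P? Q? P⇒Q xs = length-mono-≤ (filter⁺ P? Q? (λ { refl → P⇒Q }) (⊆-refl {x = xs}))

count-∪ : {P Q R : Pred A 0ℓ}
          (P? : Unary.Decidable P) (Q? : Unary.Decidable Q) (R? : Unary.Decidable R) →
          (∀ {x} → P x → Q x ⊎ R x) → ∀ xs → count P? xs ≤ count Q? xs + count R? xs
count-∪ P? Q? R? P⇒Q∪R [] = z≤n
count-∪ P? Q? R? P⇒Q∪R (x ∷ xs) with P? x | Q? x | R? x | count-∪ P? Q? R? P⇒Q∪R xs
... | no _  | yes _ | yes _ | ih = m≤n⇒m≤1+n (≤-trans ih (+-monoʳ-≤ _ (n≤1+n _)))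
... | no _  | yes _ | no _  | ih = m≤n⇒m≤1+n ih
... | no _  | no _  | yes _ | ih = ≤-trans ih (+-monoʳ-≤ _ (n≤1+n _))
... | no _  | no _  | no _  | ih = ih
... | yes _ | yes _ | yes _ | ih = s≤s (≤-trans ih (+-monoʳ-≤ _ (n≤1+n _)))
... | yes _ | yes _ | no _  | ih = s≤s ih
... | yes _ | no _  | yes _ | ih = ≤-trans (s≤s ih) (≤-reflexive (sym (+-suc _ _)))
... | yes p | no ¬q | no ¬r | ih with P⇒Q∪R p
...   | inj₁ q = contradiction q ¬q
...   | inj₂ r = contradiction r ¬r

count-map : {P : Pred B 0ℓ} (P? : Unary.Decidable P) (f : A → B) (xs : List A) →
            count P? (map f xs) ≡ count (P? ∘ f) xs
count-map P? f [] = refl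
count-map P? f (x ∷ xs) with does (P? (f x))
... | true  = cong suc (count-map P? f xs)
... | false = count-map P? f xs

count-cartesianProduct :
  {R : Pred (A × B) 0ℓ} (R? : Unary.Decidable R) (xs : List A) (ys : List B) →
  count R? (cartesianProduct xs ys) ≡ sum (map (λ x → count (λ y → R? (x , y)) ys) xs)
count-cartesianProduct R? [] ys = refl
count-cartesianProduct R? (x ∷ xs) ys =
  trans (cong length (filter-++ R? (map (x ,_) ys) (cartesianProduct xs ys)))
 (trans (length-++ (filter R? (map (x ,_) ys)))
        (cong₂ _+_ (count-map R? (x ,_) ys) (count-cartesianProduct R? xs ys)))

count-×-≤ : {P : Pred A 0ℓ} {Q : Pred B 0ℓ}
            (P? : Unary.Decidable P) (Q? : Unary.Decidable Q) (xs : List A) (ys : List B) →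
            count (λ p → P? (proj₁ p) ×-dec Q? (proj₂ p)) (cartesianProduct xs ys) ≤
            count P? xs * count Q? ys
count-×-≤ {P = P} {Q} P? Q? xs ys = ≤-trans (≤-reflexive (count-cartesianProduct P×Q? xs ys)) (go xs)
  where
  P×Q? : Unary.Decidable (λ p → P (proj₁ p) × Q (proj₂ p))
  P×Q? p = P? (proj₁ p) ×-dec Q? (proj₂ p)
  go : ∀ xs → sum (map (λ x → count (λ y → P×Q? (x , y)) ys) xs) ≤ count P? xs * count Q? ys
  go [] = z≤n
  go (x ∷ xs) with P? x
  ... | yes p = +-mono-≤ (count-mono _ Q? proj₂ ys) (go xs)
  ... | no ¬p = +-mono-≤ (≤-reflexive (cong length (filter-none _ (All.universal (λ _ → ¬p ∘ proj₁) ys))))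
                         (go xs)

count-swap : {R : REL A B 0ℓ} (R? : Decidable R) (xs : List A) (ys : List B) →
             sum (map (λ x → count (R? x) ys) xs) ≡ sum (map (λ y → count (λ x → R? x y) xs) ys)
count-swap R? [] ys = sym (sum-map-0 ys)
count-swap R? (x ∷ xs) ys =
  trans (cong (count (R? x) ys +_) (count-swap R? xs ys)) (sym (go ys))
  where
  go : ∀ ys → sum (map (λ y → count (λ x → R? x y) (x ∷ xs)) ys) ≡
              count (R? x) ys + sum (map (λ y → count (λ x → R? x y) xs) ys)
  go ys = trans (cong sum (map-cong (λ y → count-∷ (λ x → R? x y) x xs) ys))
         (trans (sum-map-+ (λ y → if does (R? x y) then 1 else 0) _ ys)
                (cong (_+ _) (sym (count-as-sum (R? x) ys))))

-- Markov's inequality, multiplied out.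
count-*-≤-sum : {P : Pred A 0ℓ} (P? : Unary.Decidable P) {k : ℕ} {f : A → ℕ} →
                (∀ {x} → P x → k ≤ f x) → ∀ xs → k * count P? xs ≤ sum (map f xs)
count-*-≤-sum P? {k} k≤f [] = ≤-reflexive (*-zeroʳ k)
count-*-≤-sum P? {k} k≤f (x ∷ xs) with P? x
... | yes p = ≤-trans (≤-reflexive (*-suc k _)) (+-mono-≤ (k≤f p) (count-*-≤-sum P? k≤f xs))
... | no _  = ≤-trans (count-*-≤-sum P? k≤f xs) (m≤n+m _ _)

AllPairs-resp-⊆ : {R : Rel A 0ℓ} {xs ys : List A} → xs ⊆ ys → AllPairs R ys → AllPairs R xs
AllPairs-resp-⊆ []         []       = []
AllPairs-resp-⊆ (_ ∷ʳ τ)   (_ ∷ rs) = AllPairs-resp-⊆ τ rs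
AllPairs-resp-⊆ (refl ∷ τ) (r ∷ rs) = All-resp-⊆ τ r ∷ AllPairs-resp-⊆ τ rs

-- Compatible families of partial assignments

-- Each x prescribes the truth value val x p of those variables p with Def x p.
module PartialAssignments {X V : Set} {Def : REL X V 0ℓ}
                          (def? : Decidable Def) (val : X → V → Bool) where

  AgreeAt : V → Rel X 0ℓ
  AgreeAt p x y = Def x p → Def y p → val x p ≡ val y p

  Agree : List V → Rel X 0ℓ
  Agree ps x y = All (λ p → AgreeAt p x y) ps

  Keeps : V → Bool → Pred X 0ℓ
  Keeps p b x = Def x p → val x p ≡ b

  keeps? : ∀ p b → Unary.Decidable (Keeps p b)
  keeps? p b x = def? x p →-dec (val x p Bool.≟ b)

  -- The number of total assignments on ps that extend the one of x.
  weight : List V → X → ℕ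
  weight []       x = 1
  weight (p ∷ ps) x = (if does (def? x p) then 1 else 2) * weight ps x

  -- Each variable contributes one factor 2 in total: to `weight` if x leaves it free, to the other
  -- power if x prescribes it.
  weight-count : ∀ ps x → weight ps x * 2 ^ count (def? x) ps ≡ 2 ^ length ps
  weight-count [] x = refl
  weight-count (p ∷ ps) x with does (def? x p)
  ... | true  = trans (shuffle (weight ps x) _) (cong (2 *_) (weight-count ps x))
    where
    shuffle : ∀ w c → 1 * w * (2 * c) ≡ 2 * (w * c)
    shuffle = solve-∀
  ... | false = trans (*-assoc 2 (weight ps x) _) (cong (2 *_) (weight-count ps x))

  -- If x prescribes p, it survives in exactly one of the two filters and its factor is 1. Otherwise
  -- `Keeps` holds vacuously, x survives in both, and this accounts for its factor 2.
  sum-weight-split : ∀ p ps xs →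
    sum (map (weight (p ∷ ps)) xs) ≡
    sum (map (weight ps) (filter (keeps? p true) xs)) +
    sum (map (weight ps) (filter (keeps? p false) xs))
  sum-weight-split p ps [] = refl
  sum-weight-split p ps (x ∷ xs) with sum-weight-split p ps xs | def? x p
  ... | ih | no _ = trans (cong (2 * weight ps x +_) ih) (both (weight ps x) _ _)
    where
    both : ∀ w a b → 2 * w + (a + b) ≡ w + a + (w + b)
    both = solve-∀
  ... | ih | yes _ with val x p
  ...   | true  = trans (cong (1 * weight ps x +_) ih) (left (weight ps x) (kept true) (kept false))
    where
    kept : Bool → ℕ
    kept b = sum (map (weight ps) (filter (keeps? p b) xs))
    left : ∀ w a b → 1 * w + (a + b) ≡ w + a + b
    left = solve-∀
  ...   | false = trans (cong (1 * weight ps x +_) ih) (right (weight ps x) (kept true) (kept false))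
    where
    kept : Bool → ℕ
    kept b = sum (map (weight ps) (filter (keeps? p b) xs))
    right : ∀ w a b → 1 * w + (a + b) ≡ a + (w + b)
    right = solve-∀

  -- Stated for sublists so that the bound passes to filtered lists in the induction on the
  -- variables.
  AgreeingSublistsBounded : ℕ → List V → List X → Set
  AgreeingSublistsBounded m ps xs =
    ∀ {ys} → ys ⊆ xs → AllPairs (Agree ps) ys → length ys ≤ m

  -- Elements that keep p at the same b agree at p automatically, so agreement on `ps` is already
  -- agreement on `p ∷ ps`.
  bounded-keeps : ∀ {m ps xs} p b → AgreeingSublistsBounded m (p ∷ ps) xs →
                  AgreeingSublistsBounded m ps (filter (keeps? p b) xs)
  bounded-keeps {xs = xs} p b bounded τ agree =
    bounded (⊆-trans τ (filter-⊆ (keeps? p b) xs))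
            (extend (All-resp-⊆ τ (all-filter (keeps? p b) xs)) agree)
    where
    agreeAt : ∀ {x y} → Keeps p b x → Keeps p b y → AgreeAt p x y
    agreeAt kx ky dx dy = trans (kx dx) (sym (ky dy))
    extend : ∀ {ps ys} → All (Keeps p b) ys → AllPairs (Agree ps) ys → AllPairs (Agree (p ∷ ps)) ys
    extend []       []       = []
    extend (k ∷ ks) (r ∷ rs) =
      All.zipWith (λ (k′ , r) → agreeAt k k′ ∷ r) (ks , r) ∷ extend ks rs

  -- Double counting of pairs of a total assignment and an x that it extends: all x extended by one
  -- assignment agree pairwise, so there are at most m. The induction branches on the value of each
  -- variable in turn.
  sum-weight-≤ : ∀ {m} ps xs → AgreeingSublistsBounded m ps xs →
                 sum (map (weight ps) xs) ≤ m * 2 ^ length ps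
  sum-weight-≤ {m} [] xs bounded =
    -- With no variables left, agreement is vacuous, so the hypothesis applies to the whole list.
    ≤-trans (≤-reflexive (sum-ones xs))
            (≤-trans (bounded ⊆-refl (agree xs)) (≤-reflexive (sym (*-identityʳ m))))
    where
    sum-ones : ∀ xs → sum (map (weight []) xs) ≡ length xs
    sum-ones []       = refl
    sum-ones (_ ∷ xs) = cong suc (sum-ones xs)
    agree : ∀ xs → AllPairs (Agree []) xs
    agree []       = []
    agree (_ ∷ xs) = All.universal (λ _ → []) xs ∷ agree xs
  sum-weight-≤ {m} (p ∷ ps) xs bounded = begin
    sum (map (weight (p ∷ ps)) xs)
      ≡⟨ sum-weight-split p ps xs ⟩
    sum (map (weight ps) (filter (keeps? p true) xs)) +
    sum (map (weight ps) (filter (keeps? p false) xs))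
      ≤⟨ +-mono-≤ (sum-weight-≤ ps _ (bounded-keeps p true bounded))
                  (sum-weight-≤ ps _ (bounded-keeps p false bounded)) ⟩
    m * 2 ^ length ps + m * 2 ^ length ps
      ≡⟨ double m (2 ^ length ps) ⟩
    m * 2 ^ length (p ∷ ps) ∎
    where
    open ≤-Reasoning
    double : ∀ m n → m * n + m * n ≡ m * (2 * n)
    double = solve-∀

  -- By `weight-count` every weight is at least 2^(length ps) / 2^D, while `sum-weight-≤` caps their
  -- sum. The powers of 2 are cleared instead of divided.
  length-≤ : ∀ {m D} ps xs → AgreeingSublistsBounded m ps xs →
             All (λ x → count (def? x) ps ≤ D) xs → length xs ≤ m * 2 ^ D
  length-≤ {m} {D} ps xs bounded small =
    *-cancelʳ-≤ _ _ (2 ^ length ps) {{m^n≢0 2 (length ps)}} (begin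
      length xs * 2 ^ length ps         ≤⟨ each xs small ⟩
      sum (map (weight ps) xs) * 2 ^ D  ≤⟨ *-monoˡ-≤ (2 ^ D) (sum-weight-≤ ps xs bounded) ⟩
      m * 2 ^ length ps * 2 ^ D         ≡⟨ shuffle m (2 ^ length ps) (2 ^ D) ⟩
      m * 2 ^ D * 2 ^ length ps         ∎)
    where
    open ≤-Reasoning
    shuffle : ∀ a b c → a * b * c ≡ a * c * b
    shuffle = solve-∀
    each : ∀ xs → All (λ x → count (def? x) ps ≤ D) xs →
           length xs * 2 ^ length ps ≤ sum (map (weight ps) xs) * 2 ^ D
    each [] [] = z≤n
    each (x ∷ xs) (c ∷ cs) = begin
      2 ^ length ps + length xs * 2 ^ length ps
        ≤⟨ +-mono-≤ (≤-trans (≤-reflexive (sym (weight-count ps x)))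
                             (*-monoʳ-≤ (weight ps x) (^-monoʳ-≤ 2 c)))
                    (each xs cs) ⟩
      weight ps x * 2 ^ D + sum (map (weight ps) xs) * 2 ^ D
        ≡⟨ *-distribʳ-+ (2 ^ D) (weight ps x) _ ⟨
      (weight ps x + sum (map (weight ps) xs)) * 2 ^ D ∎

-- Degrees

module _ {n : ℕ} (H : EdgeOrderedGraph n) where

  deg : Fin n → ℕ
  deg x = count (adj? H x) (allFin n)

  -- Half of the handshake lemma. A neighbour of x is larger or smaller than x, and summing either
  -- kind over x counts each edge once, the second after exchanging the sums.
  sum-deg-≤ : sum (map deg (allFin n)) ≤ edgeCount H + edgeCount H
  sum-deg-≤ = begin
    sum (map deg (allFin n))
      ≤⟨ sum-map-mono (λ x → count-∪ (adj? H x) (up? x) (λ y → up? y x) split (allFin n)) (allFin n) ⟩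
    sum (map (λ x → count (up? x) (allFin n) + count (λ y → up? y x) (allFin n)) (allFin n))
      ≡⟨ sum-map-+ _ _ (allFin n) ⟩
    sum (map (λ x → count (up? x) (allFin n)) (allFin n)) +
    sum (map (λ x → count (λ y → up? y x) (allFin n)) (allFin n))
      ≡⟨ cong (sum (map (λ x → count (up? x) (allFin n)) (allFin n)) +_)
              (sym (count-swap up? (allFin n) (allFin n))) ⟩
    sum (map (λ x → count (up? x) (allFin n)) (allFin n)) +
    sum (map (λ x → count (up? x) (allFin n)) (allFin n))
      ≡⟨ cong₂ _+_ (sym edges) (sym edges) ⟩
    edgeCount H + edgeCount H ∎
    where
    open ≤-Reasoning
    up? : Decidable (λ x y → x <ᶠ y × Adj H x y)
    up? x y = (x <ᶠ? y) ×-dec adj? H x y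
    split : ∀ {x y} → Adj H x y → (x <ᶠ y × Adj H x y) ⊎ (y <ᶠ x × Adj H y x)
    split {x} {y} e with <ᶠ-cmp x y
    ... | tri< x<y _ _    = inj₁ (x<y , e)
    ... | tri≈ _ refl _   = contradiction e (adj-irrefl H)
    ... | tri> _ _ y<x    = inj₂ (y<x , adj-sym H e)
    edges : edgeCount H ≡ sum (map (λ x → count (up? x) (allFin n)) (allFin n))
    edges = count-cartesianProduct (λ p → up? (proj₁ p) (proj₂ p)) (allFin n) (allFin n)

  -- The members after the first are all neighbours of the first. Being a sublist of `allFin n`
  -- ensures that its degree counts them with multiplicity.
  clique-length-≤ : ∀ {d ys} → ys ⊆ allFin n → AllPairs (Adj H) ys →
                    All (λ y → deg y ≤ d) ys → length ys ≤ suc d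
  clique-length-≤ _ [] [] = z≤n
  clique-length-≤ {ys = y ∷ ys} τ (adj ∷ _) (deg≤d ∷ _) = s≤s (begin
    length ys             ≡⟨ cong length (filter-all (adj? H y) adj) ⟨
    count (adj? H y) ys   ≤⟨ length-mono-≤ (filter⁺ (adj? H y) (adj? H y) (λ { refl → id })
                               (⊆-trans (y ∷ʳ ⊆-refl) τ)) ⟩
    deg y                 ≤⟨ deg≤d ⟩
    _                     ∎)
    where open ≤-Reasoning

-- Semi-saturated graphs

-- The image of the four edges av, aw, bv, bw: all that the counting uses of a copy of G.
Crossing : {n : ℕ} → EdgeOrderedGraph n → Rel (Fin n) 0ℓ
Crossing H x y = ∃[ v ] ∃[ w ]
  (Adj H x v × Adj H x w × label H x v < label H x w) ×
  (Adj H y v × Adj H y w × label H y w < label H y v)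

Crossing-sym : {n : ℕ} (H : EdgeOrderedGraph n) {x y : Fin n} → Crossing H x y → Crossing H y x
Crossing-sym H (v , w , (xv , xw , v<w) , (yv , yw , w<v)) =
  w , v , (yw , yv , w<v) , (xw , xv , v<w)

module _ {n : ℕ} (H : EdgeOrderedGraph n) {x y : Fin n} (m : Missing H x y) where

  label-new : ∀ {u v} → SameEdge u v x y → label (addFirst H x y m) u v ≡ 0
  label-new {u} {v} e =
    cong (λ b → if b then 0 else suc (label H u v)) (dec-true (sameEdge? u v x y) e)

  label-old : ∀ {u v} → ¬ SameEdge u v x y → label (addFirst H x y m) u v ≡ suc (label H u v)
  label-old {u} {v} ¬e =
    cong (λ b → if b then 0 else suc (label H u v)) (dec-false (sameEdge? u v x y) ¬e)

module _ {k n : ℕ} (G : EdgeOrderedGraph k) {a b v w : Fin k}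
         (minimal : IsMinimalEdge G a b)
         (Nv : v ∈ N G a ∩ N G b) (Nw : w ∈ N G a ∩ N G b)
         (av<aw : label G a v < label G a w) (bw<bv : label G b w < label G b v)
         (H : EdgeOrderedGraph n) where

  module _ {x y : Fin n} (m : Missing H x y) (c : Copy G (addFirst H x y m)) where

    -- The new edge has label 0. If it were the image of an edge above ab, the image of ab would
    -- need a label below 0. So it is the image of an edge with the label of ab, which is ab itself.
    copy-minimal : Uses c x y → SameEdge (to c a) (to c b) x y
    copy-minimal (u , u′ , e , same) with m≤n⇒m<n∨m≡n (proj₂ minimal e)
    ... | inj₁ ab<uu′ =
      contradiction (subst (_ <_) (label-new H m same) (order-pres c (proj₁ minimal) e ab<uu′)) (λ ())
    ... | inj₂ ab≡uu′ with label-injective G (proj₁ minimal) e ab≡uu′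
    ...   | inj₁ (refl , refl) = same
    ...   | inj₂ (refl , refl) with same
    ...     | inj₁ (p , q) = inj₂ (q , p)
    ...     | inj₂ (p , q) = inj₁ (q , p)

    -- The images of s and t exhaust the endpoints of the new edge, so by injectivity the image of u
    -- is neither endpoint.
    avoids-new-edge : ∀ {s t z} → SameEdge (to c s) (to c t) x y → ∀ {u} → u ≢ s → u ≢ t →
                      ¬ SameEdge z (to c u) x y
    avoids-new-edge (inj₁ (_ , t)) u≢s u≢t (inj₁ (_ , u)) = u≢t (injective c (trans u (sym t)))
    avoids-new-edge (inj₁ (s , _)) u≢s u≢t (inj₂ (_ , u)) = u≢s (injective c (trans u (sym s)))
    avoids-new-edge (inj₂ (_ , t)) u≢s u≢t (inj₂ (_ , u)) = u≢t (injective c (trans u (sym t)))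
    avoids-new-edge (inj₂ (s , _)) u≢s u≢t (inj₁ (_ , u)) = u≢s (injective c (trans u (sym s)))

    -- The edges from a and b to v and w are not mapped to the new edge, so their images lie in H.
    -- Their labels are all shifted by one, which preserves comparisons.
    copy-crossing : SameEdge (to c a) (to c b) x y → Crossing H (to c a) (to c b)
    copy-crossing same =
      to c v , to c w ,
      (adj Nv (proj₁ Nv) , adj Nw (proj₁ Nw) , lab Nv Nw (proj₁ Nv) (proj₁ Nw) av<aw) ,
      (adj Nv (proj₂ Nv) , adj Nw (proj₂ Nw) , lab Nw Nv (proj₂ Nw) (proj₂ Nv) bw<bv)
      where
      ≢-nbr : ∀ {s t} → Adj G s t → t ≢ s
      ≢-nbr e refl = adj-irrefl G e
      fresh : ∀ {u z} → u ∈ N G a ∩ N G b → ¬ SameEdge z (to c u) x y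
      fresh (au , bu) = avoids-new-edge same (≢-nbr au) (≢-nbr bu)
      adj : ∀ {s u} → u ∈ N G a ∩ N G b → Adj G s u → Adj H (to c s) (to c u)
      adj Nu e with adj-pres c e
      ... | inj₁ new = contradiction new (fresh Nu)
      ... | inj₂ old = old
      lab : ∀ {s u u′} → u ∈ N G a ∩ N G b → u′ ∈ N G a ∩ N G b → Adj G s u → Adj G s u′ →
            label G s u < label G s u′ → label H (to c s) (to c u) < label H (to c s) (to c u′)
      lab Nu Nu′ e e′ lt =
        ≤-pred (subst₂ _<_ (label-old H m (fresh Nu)) (label-old H m (fresh Nu′)) (order-pres c e e′ lt))

  semiSaturated⇒crossing : SemiSaturated G H → ∀ {x y} → Missing H x y → Crossing H x y
  semiSaturated⇒crossing sat {x} {y} m with sat x y m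
  ... | c , uses with copy-minimal m c uses
  ...   | same@(inj₁ (p , q)) = subst₂ (Crossing H) p q (copy-crossing m c same)
  ...   | same@(inj₂ (p , q)) = Crossing-sym H (subst₂ (Crossing H) p q (copy-crossing m c same))

-- Low-degree vertices and the resulting edge bound

module _ {n : ℕ} (H : EdgeOrderedGraph n)
         (crossing : ∀ {x y} → Missing H x y → Crossing H x y) where

  private
    pairs : List (Fin n × Fin n)
    pairs = cartesianProduct (allFin n) (allFin n)

    nbrs? : Decidable (λ x (p : Fin n × Fin n) → Adj H x (proj₁ p) × Adj H x (proj₂ p))
    nbrs? x p = adj? H x (proj₁ p) ×-dec adj? H x (proj₂ p)

    precedes : Fin n → Fin n × Fin n → Bool
    precedes x (v , w) = does (label H x v <? label H x w)

    open PartialAssignments nbrs? precedes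

    -- If xy were missing, both vertices would prescribe the pair `(v , w)` of a crossing, x as true
    -- and y as false because the order is reversed at y.
    agree⇒adj : ∀ {x y} → x ≢ y × Agree pairs x y → Adj H x y
    agree⇒adj {x} {y} (x≢y , agree) with adj? H x y
    ... | yes e = e
    ... | no ¬e with crossing (x≢y , ¬e)
    ...   | v , w , (xv , xw , v<w) , (yv , yw , w<v)
      with All.lookup agree (∈-cartesianProduct⁺ (∈-allFin v) (∈-allFin w)) (xv , xw) (yv , yw)
    ...   | eq with trans (sym (dec-true (_ <? _) v<w)) (trans eq (dec-false (_ <? _) (<-asym w<v)))
    ...     | ()

  count-low-≤ : ∀ d → count (λ x → deg H x ≤? d) (allFin n) ≤ suc d * 2 ^ (d * d)
  -- A vertex of degree at most d prescribes at most `d * d` pairs, and agreeing vertices form a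
  -- clique, of size at most `suc d`.
  count-low-≤ d = length-≤ pairs low bounded
    (All.map (λ {x} deg≤d → ≤-trans (count-×-≤ (adj? H x) (adj? H x) (allFin n) (allFin n))
                                    (*-mono-≤ deg≤d deg≤d))
             low-deg)
    where
    low = filter (λ x → deg H x ≤? d) (allFin n)
    low-deg : All (λ x → deg H x ≤ d) low
    low-deg = all-filter (λ x → deg H x ≤? d) (allFin n)
    low⊆ : low ⊆ allFin n
    low⊆ = filter-⊆ (λ x → deg H x ≤? d) (allFin n)
    bounded : AgreeingSublistsBounded (suc d) pairs low
    bounded τ agree = clique-length-≤ H (⊆-trans τ low⊆)
      (AllPairs.map agree⇒adj
        -- Distinctness, which `agree⇒adj` needs, is inherited from `allFin n`.
        (AllPairs.zip (AllPairs-resp-⊆ (⊆-trans τ low⊆) (allFin⁺ n) , agree)))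
      (All-resp-⊆ τ low-deg)

  -- By `count-low-≤` and the hypothesis at most n / 2 vertices have degree at most d, so the other
  -- n / 2 or more give a degree sum of at least n (d + 1) / 2, which is at most twice the number of
  -- edges.
  edges-≥ : ∀ d → 2 * (suc d * 2 ^ (d * d)) ≤ n → n * suc d ≤ 4 * edgeCount H
  edges-≥ d small = begin
    n * suc d                          ≤⟨ *-monoˡ-≤ (suc d) n≤2high ⟩
    2 * high * suc d                   ≡⟨ shuffle high (suc d) ⟩
    2 * (suc d * high)                 ≤⟨ *-monoʳ-≤ 2 (count-*-≤-sum (λ x → suc d ≤? deg H x) id (allFin n)) ⟩
    2 * sum (map (deg H) (allFin n))   ≤⟨ *-monoʳ-≤ 2 (sum-deg-≤ H) ⟩
    2 * (edgeCount H + edgeCount H)    ≡⟨ quadruple (edgeCount H) ⟩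
    4 * edgeCount H                    ∎
    where
    open ≤-Reasoning
    low  = count (λ x → deg H x ≤? d) (allFin n)
    high = count (λ x → suc d ≤? deg H x) (allFin n)
    shuffle : ∀ h k → 2 * h * k ≡ 2 * (k * h)
    shuffle = solve-∀
    quadruple : ∀ e → 2 * (e + e) ≡ 4 * e
    quadruple = solve-∀
    n≤low+high : n ≤ low + high
    n≤low+high = begin
      n                                    ≡⟨ length-tabulate {n = n} id ⟨
      length (allFin n)                    ≡⟨ cong length (filter-all U? (All.universal (λ _ → _) (allFin n))) ⟨
      count U? (allFin n)                  ≤⟨ count-∪ U? _ _ (λ {x} _ → ≤-<-connex (deg H x) d) (allFin n) ⟩
      low + high                           ∎
    n≤2high : n ≤ 2 * high
    -- Adding n to both sides replaces the subtraction of the low vertices.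
    n≤2high = +-cancelˡ-≤ n _ _ (begin
      n + n                 ≡⟨ cong (n +_) (+-identityʳ n) ⟨
      2 * n                 ≤⟨ *-monoʳ-≤ 2 n≤low+high ⟩
      2 * (low + high)      ≡⟨ *-distribˡ-+ 2 low high ⟩
      2 * low + 2 * high    ≤⟨ +-monoˡ-≤ (2 * high) (≤-trans (*-monoʳ-≤ 2 (count-low-≤ d)) small) ⟩
      n + 2 * high          ∎)

-- The choice of d

k<⌈log₂n⌉⇒2^k<n : ∀ {k n} → k < ⌈log₂ n ⌉ → 2 ^ k < n
k<⌈log₂n⌉⇒2^k<n {k} k<log = ≰⇒> λ n≤2^k →
  <⇒≱ k<log (≤-trans (⌈log₂⌉-mono-≤ n≤2^k) (≤-reflexive (⌈log₂2^n⌉≡n k)))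

-- Descends from m, keeping L below the current value, until f first drops to L or lower.
last-below : (f : ℕ → ℕ) (L m : ℕ) → f 0 ≤ L → L < f m → ∃[ d ] f d ≤ L × L < f (suc d)
last-below f L zero    f0≤L L<f0 = contradiction f0≤L (<⇒≱ L<f0)
last-below f L (suc m) f0≤L L<fm⁺ with f m ≤? L
... | yes fm≤L = m , fm≤L , L<fm⁺
... | no  fm≰L = last-below f L m f0≤L (≰⇒> fm≰L)

n<2^n : ∀ n → n < 2 ^ n
n<2^n zero    = s≤s z≤n
n<2^n (suc n) = +-mono-≤ (m^n>0 2 n) (≤-trans (n<2^n n) (≤-reflexive (sym (+-identityʳ _))))

-- As 2 (d + 1) 2^(d²) ≤ 2^(d² + d + 1), it suffices that d² + d + 1 < ⌈log₂ n⌉.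
threshold : ∀ {n} → 2 ≤ ⌈log₂ n ⌉ →
            ∃[ d ] 2 * (suc d * 2 ^ (d * d)) ≤ n × ⌈log₂ n ⌉ ≤ 4 * (suc d * suc d)
-- The summand 2 turns the strict bound on d² + d + 1 into `≤`. It is also the value at 0, whence
-- `2 ≤ L`; at `L` the value exceeds `L`, so the search can start there.
threshold {n} 2≤L with last-below (λ d → d * d + d + 2) L L 2≤L
  (≤-trans (m<m+n L (s≤s z≤n)) (+-monoˡ-≤ 2 (m≤n+m L (L * L))))
  where L = ⌈log₂ n ⌉
... | d , lower , upper = d , small , large
  where
  open ≤-Reasoning
  small : 2 * (suc d * 2 ^ (d * d)) ≤ n
  small = begin
    -- `d < 2 ^ d` unfolds to `suc d ≤ 2 ^ d`.
    2 * (suc d * 2 ^ (d * d))    ≤⟨ *-monoʳ-≤ 2 (*-monoˡ-≤ (2 ^ (d * d)) (n<2^n d)) ⟩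
    2 * (2 ^ d * 2 ^ (d * d))    ≡⟨ cong (2 *_) (trans (sym (^-distribˡ-+-* 2 d (d * d))) (cong (2 ^_) (+-comm d (d * d)))) ⟩
    2 ^ suc (d * d + d)          ≤⟨ <⇒≤ (k<⌈log₂n⌉⇒2^k<n (≤-trans (≤-reflexive (+-comm 2 (d * d + d))) lower)) ⟩
    n                            ∎
  slack : ∀ d → 4 * (suc d * suc d) ≡ (suc d * suc d + suc d + 2) + (3 * d * d + 5 * d)
  slack = solve-∀
  large : ⌈log₂ n ⌉ ≤ 4 * (suc d * suc d)
  large = begin
    ⌈log₂ n ⌉                                              ≤⟨ <⇒≤ upper ⟩
    suc d * suc d + suc d + 2                              ≤⟨ m≤m+n _ _ ⟩
    (suc d * suc d + suc d + 2) + (3 * d * d + 5 * d)      ≡⟨ slack d ⟨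
    4 * (suc d * suc d)                                    ∎

4≤n⇒2≤⌈log₂n⌉ : ∀ {n} → 4 ≤ n → 2 ≤ ⌈log₂ n ⌉
4≤n⇒2≤⌈log₂n⌉ {n} 4≤n = subst (_≤ ⌈log₂ n ⌉) (⌈log₂2^n⌉≡n 2) (⌈log₂⌉-mono-≤ {2 ^ 2} {n} 4≤n)

-- Squaring replaces the square root. With k = d + 1 the factor `4 * (k * k)` is the bound on the
-- logarithm from `threshold`.
square-bound : ∀ n k e → n * k ≤ 4 * e → n ^ 2 * (4 * (k * k)) ≤ (8 * e) ^ 2
square-bound n k e nk≤4e = begin
  n ^ 2 * (4 * (k * k))  ≡⟨ square n k ⟩
  (2 * (n * k)) ^ 2      ≤⟨ ^-monoˡ-≤ 2 (*-monoʳ-≤ 2 nk≤4e) ⟩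
  (2 * (4 * e)) ^ 2      ≡⟨ cong (_^ 2) (sym (*-assoc 2 4 e)) ⟩
  (8 * e) ^ 2            ∎
  where
  open ≤-Reasoning
  square : ∀ n k → n * (n * 1) * (4 * (k * k)) ≡ 2 * (n * k) * (2 * (n * k) * 1)
  square = solve-∀

theorem18 : {k : ℕ} (G : EdgeOrderedGraph k) (a b v w : Fin k) →
    IsMinimalEdge G a b →
    v ∈ N G a ∩ N G b →
    w ∈ N G a ∩ N G b →
    label G a v < label G a w →
    label G b w < label G b v →
    (∀ n s t → ssatₘ G n s → satₘ G n t → s ≤ t) × Ω[n√logn] (ssatₘ G)
-- The constant 8 is the 4 of `edges-≥` times the root of the 4 in `threshold`; n ≥ 4 makes the
-- logarithm at least 2.
theorem18 G a b v w minimal Nv Nw av<aw bw<bv = ssat≤sat , 8 , 4 , lower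
  where
  ssat≤sat : ∀ n s t → ssatₘ G n s → satₘ G n t → s ≤ t
  -- An optimal saturated graph competes in the minimum that defines s.
  ssat≤sat n s t (_ , s-least) ((H , (_ , semi) , edges) , _) = s-least t (H , semi , edges)
  lower : ∀ n s → 4 ≤ n → ssatₘ G n s → n ^ 2 * ⌈log₂ n ⌉ ≤ (8 * s) ^ 2
  lower n s 4≤n ((H , semi , refl) , _) =
    let crossing = semiSaturated⇒crossing G minimal Nv Nw av<aw bw<bv H semi
        d , small , large = threshold (4≤n⇒2≤⌈log₂n⌉ 4≤n)
    in ≤-trans (*-monoʳ-≤ (n ^ 2) large)
               (square-bound n (suc d) (edgeCount H) (edges-≥ H crossing d small))
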